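{- For each integer $k\ge 3$, asymptotically almost surely (i.e., with probability tending to $1$ as $n\to\infty$), $$t(W_k(n))\ge \frac{1.64k}{k+1}\cdot\frac{n}{k}.$$
   Context: A word $w=w_1\cdots w_n$ over a finite alphabet contains twins of length $t$ if there exist disjoint index sets $\{i_1<\cdots<i_t\}$ and $\{j_1<\cdots<j_t\}$ with $w_{i_1}\cdots w_{i_t}=w_{j_1}\cdots w_{j_t}$; $t(w)$ is the maximum length of twins in $w$. $W_k(n)$ is a word chosen uniformly at random among all $k^n$ words of length $n$ over a $k$-letter alphabet. -}

module Defs where

open import Data.Nat using (ℕ; _*_; _^_; _≤_; _<_)
open import Data.Fin using (Fin)
open import Data.Vec using (Vec; lookup)
open import Data.List using (List; length)
open import Data.List.Relation.Unary.All using (All)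
open import Data.List.Relation.Unary.Unique.Propositional using (Unique)
open import Data.Product using (Σ; ∃; _×_)
open import Relation.Binary.PropositionalEquality using (_≡_; _≢_)
import Data.Fin as F

Word : ℕ → ℕ → Set
Word k n = Vec (Fin k) n

StrictlyIncreasing : {t n : ℕ} → (Fin t → Fin n) → Set
StrictlyIncreasing {t} f = ∀ (a b : Fin t) → a F.< b → f a F.< f b

HasTwins : {k n : ℕ} → Word k n → ℕ → Set
HasTwins {k} {n} w t =
  Σ (Fin t → Fin n) λ i → Σ (Fin t → Fin n) λ j →
    StrictlyIncreasing i × StrictlyIncreasing j
    × (∀ (a b : Fin t) → i a ≢ j b)
    × (∀ (a : Fin t) → lookup w (i a) ≡ lookup w (j a))

-- t(w) ≥ 1.64 n / (k+1), i.e. w has twins of some length t with 100 (k+1) t ≥ 164 n.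
-- (Note 1.64k/(k+1) · n/k = 1.64 n/(k+1).)
GoodWord : (k n : ℕ) → Word k n → Set
GoodWord k n w = ∃ λ t → HasTwins w t × (164 * n ≤ 100 * (Data.Nat.suc k) * t)
  where import Data.Nat

-- Asymptotically almost surely for the uniform word W_k(n):
-- for every m, eventually at least a (1 - 1/(m+1)) fraction of the k^n words are good,
-- witnessed by a duplicate-free list of good words.
AAS : (k : ℕ) → ((n : ℕ) → Word k n → Set) → Set
AAS k P = ∀ (m : ℕ) → ∃ λ N → ∀ n → N ≤ n →
  Σ (List (Word k n)) λ L → Unique L × All (P n) L
    × (m * k ^ n ≤ Data.Nat.suc m * length L)
  where import Data.Nat

{-# OPTIONS --safe #-}

-- Read the word from left to right: the leading twin is ahead of the trailing one by a queue of
-- letters still to be matched, and the trailing twin may advance when the next letter occurs in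
-- the queue (the letters in front of it are given up).  Queues are restricted to the shapes
-- ∅, a, ab, abb, abc, abcc with a, b, c distinct, so up to renaming of letters the queue is a
-- finite Markov chain.  With a suitable potential on the shapes, polynomial in k, the quantity
-- "hits + potential − drift · time" is a martingale with bounded increments; its second moment
-- is O(n), so by Chebyshev's inequality all but a fraction O(1/n) of the words have at least
-- (drift − ε) n hits.  The drift k (9k² − 4k + 8) / (4k⁴ + 2k³ + 20k² + 2k − 2) exceeds
-- 1.64 / (k + 1) for every k ≥ 3 (for k = 3 it is 231/562 > 0.411).

module Submission where

open import Defs
open import Data.Bool using (Bool; true; false)
open import Data.Fin as Fin using (Fin)
open import Data.Fin.Patterns
open import Data.Fin.Properties using (_≟_; suc-injective; 0≢1+n)
open import Data.Integer as ℤ using (ℤ; +_; -_; -[1+_]; ∣_∣; 0ℤ; _+_; _*_; _-_; +≤+)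
open import Data.Integer.Properties hiding (_≟_)
open import Data.Integer.Solver using (module +-*-Solver)
open import Data.Integer.Tactic.RingSolver using (solve-∀)
open import Data.List as List
  using (List; []; _∷_; _++_; [_]; length; map; filter; allFin; cartesianProductWith)
open import Data.List.Membership.Propositional using (_∈_)
open import Data.List.Membership.Propositional.Properties using (∈-allFin)
open import Data.List.Properties using (++-assoc; length-tabulate; length-map; length-++)
open import Data.List.Relation.Binary.Sublist.Propositional
  using (_⊆_; []; _∷_; _∷ʳ_; ⊆-trans; ⊆-refl; minimum)
open import Data.List.Relation.Unary.All as All using (All; []; _∷_)
open import Data.List.Relation.Unary.All.Properties using (all-filter)
open import Data.List.Relation.Unary.AllPairs using ([]; _∷_)
open import Data.List.Relation.Unary.Any using (here; there)
open import Data.List.Relation.Unary.Unique.Propositional using (Unique)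
open import Data.List.Relation.Unary.Unique.Propositional.Properties
  using (allFin⁺; cartesianProductWith⁺; filter⁺)
import Data.Nat as ℕ
open import Data.Nat using (ℕ; zero; suc; _^_; _≤_; z<s; s<s; s<s⁻¹)
import Data.Nat.Properties as ℕ
import Data.Nat.Tactic.RingSolver as ℕ
open import Data.Product using (∃; _×_; _,_; proj₁; proj₂)
open import Data.Vec as Vec using (Vec; []; _∷_)
open import Data.Vec.Properties using (∷-injective; lookup∘tabulate)
open import Relation.Binary.PropositionalEquality
  using (_≡_; _≢_; _≗_; refl; sym; trans; cong; cong₂; subst; ≢-sym; module ≡-Reasoning)
open import Relation.Nullary using (¬_; yes; no; contradiction)
open import Relation.Unary using (Decidable)

private variable
  A B C : Set
  k n t : ℕ
  x : A
  p q u v : List A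
  w : Vec A n

-- Twins as splittings of a word, built letter by letter.

-- Each letter goes to the first list, to the second or to neither, so the order and the
-- disjointness of the two index sets hold by construction; twins are a split into two equal lists.
data Split {A : Set} : Vec A n → List A → List A → Set where
  []    : Split [] [] []
  skip  : Split w u v → Split (x ∷ w) u v
  left  : Split w u v → Split (x ∷ w) (x ∷ u) v
  right : Split w u v → Split (x ∷ w) u (x ∷ v)

swap : Split w u v → Split w v u
swap []        = []
swap (skip s)  = skip (swap s)
swap (left s)  = right (swap s)
swap (right s) = left (swap s)

position : {w : Vec A n} → Split w u v → Fin (length u) → Fin n
position (skip s)  i           = Fin.suc (position s i)
position (left s)  Fin.zero    = Fin.zero
position (left s)  (Fin.suc i) = Fin.suc (position s i)
position (right s) i           = Fin.suc (position s i)

position-increasing : (s : Split w u v) → StrictlyIncreasing (position s)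
position-increasing (skip s)  a           b           a<b = s<s (position-increasing s a b a<b)
position-increasing (left s)  Fin.zero    (Fin.suc b) a<b = z<s
position-increasing (left s)  (Fin.suc a) (Fin.suc b) a<b = s<s (position-increasing s a b (s<s⁻¹ a<b))
position-increasing (right s) a           b           a<b = s<s (position-increasing s a b a<b)

lookup-position : (s : Split w u v) (i : Fin (length u)) → Vec.lookup w (position s i) ≡ List.lookup u i
lookup-position (skip s)  i           = lookup-position s i
lookup-position (left s)  Fin.zero    = refl
lookup-position (left s)  (Fin.suc i) = lookup-position s i
lookup-position (right s) i           = lookup-position s i

positions-disjoint : (s : Split w u v) (i : Fin (length u)) (j : Fin (length v)) →
                     position s i ≢ position (swap s) j
positions-disjoint (skip s)  i           j           eq = positions-disjoint s i j (suc-injective eq)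
positions-disjoint (left s)  Fin.zero    j           eq = 0≢1+n eq
positions-disjoint (left s)  (Fin.suc i) j           eq = positions-disjoint s i j (suc-injective eq)
positions-disjoint (right s) i           Fin.zero    eq = 0≢1+n (sym eq)
positions-disjoint (right s) i           (Fin.suc j) eq = positions-disjoint s i j (suc-injective eq)

-- The leading twin is ahead of the trailing one by the queue q when w is about to be read;
-- it gives up the letters of q outside pending and gains the letters of lead from w.
record Completion {A : Set} {n : ℕ} (q : List A) (w : Vec A n) (t : ℕ) : Set where
  constructor completion
  field
    {pending lead} : List A
    pending⊆queue  : pending ⊆ q
    split          : Split w lead (pending ++ lead)
    gains          : length (pending ++ lead) ≡ t

stop : Completion q [] 0
stop {q = q} = completion (minimum q) [] refl

drop : Completion q w t → Completion q (x ∷ w) t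
drop (completion p⊆q s e) = completion p⊆q (skip s) e

weaken : p ⊆ q → Completion p w t → Completion q w t
weaken p⊆q (completion r⊆p s e) = completion (⊆-trans r⊆p p⊆q) s e

match : Completion q w t → Completion (x ∷ q) (x ∷ w) (suc t)
match (completion p⊆q s e) = completion (refl ∷ p⊆q) (right s) (cong suc e)

-- Separates whether a subsequence of `q ++ [ x ]` uses the final `x`, that is, whether the leading
-- twin keeps a letter just put into the queue.
data SnocView {A : Set} (q : List A) (x : A) : List A → Set where
  without : p ⊆ q → SnocView q x p
  with-last : p ⊆ q → SnocView q x (p ++ [ x ])

snocView : ∀ (q : List A) → p ⊆ q ++ [ x ] → SnocView q x p
snocView []      (_ ∷ʳ [])   = without []
snocView []      (refl ∷ []) = with-last []
snocView (y ∷ q) (_ ∷ʳ s) with snocView q s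
... | without r   = without (y ∷ʳ r)
... | with-last r = with-last (y ∷ʳ r)
snocView (y ∷ q) (refl ∷ s) with snocView q s
... | without r   = without (refl ∷ r)
... | with-last r = with-last (refl ∷ r)

-- If `x` is kept, it moves from the end of `pending` to the front of `lead`, which leaves
-- `pending ++ lead` unchanged; if it is given up, it is skipped in the word.
push : Completion (q ++ [ x ]) w t → Completion q (x ∷ w) t
push {q = q} {x = x} (completion {lead = u} p⊆ s e) with snocView q p⊆
... | without p⊆q   = completion p⊆q (skip s) e
... | with-last {p = p} p⊆q rewrite ++-assoc p [ x ] u = completion p⊆q (left s) e

-- An empty queue forces `pending` to be empty, so both sides of the split are `lead`.
completion⇒twins : {k : ℕ} {w : Word k n} → Completion [] w t → HasTwins w t
completion⇒twins (completion [] s refl) =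
  position s , position (swap s) , position-increasing s , position-increasing (swap s) ,
  positions-disjoint s ,
  λ i → trans (lookup-position s i) (sym (lookup-position (swap s) i))

-- Sums and counting

∑ : List A → (A → ℤ) → ℤ
∑ []       f = 0ℤ
∑ (x ∷ xs) f = f x + ∑ xs f

∑-cong : (xs : List A) {f g : A → ℤ} → f ≗ g → ∑ xs f ≡ ∑ xs g
∑-cong []       f≗g = refl
∑-cong (x ∷ xs) f≗g = cong₂ _+_ (f≗g x) (∑-cong xs f≗g)

∑-mono : (xs : List A) {f g : A → ℤ} → (∀ x → f x ℤ.≤ g x) → ∑ xs f ℤ.≤ ∑ xs g
∑-mono []       f≤g = ≤-refl
∑-mono (x ∷ xs) f≤g = +-mono-≤ (f≤g x) (∑-mono xs f≤g)

∑-+ : (xs : List A) (f g : A → ℤ) → ∑ xs (λ x → f x + g x) ≡ ∑ xs f + ∑ xs g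
∑-+ []       f g = refl
∑-+ (x ∷ xs) f g rewrite ∑-+ xs f g = interchange (f x) (g x) (∑ xs f) (∑ xs g)
  where
  interchange : ∀ a b c d → a + b + (c + d) ≡ a + c + (b + d)
  interchange = solve-∀

∑-*ˡ : (xs : List A) (c : ℤ) (f : A → ℤ) → ∑ xs (λ x → c * f x) ≡ c * ∑ xs f
∑-*ˡ []       c f = sym (*-zeroʳ c)
∑-*ˡ (x ∷ xs) c f rewrite ∑-*ˡ xs c f = sym (*-distribˡ-+ c (f x) (∑ xs f))

∑-const : (xs : List A) (c : ℤ) → ∑ xs (λ _ → c) ≡ + length xs * c
∑-const []       c = refl
∑-const (x ∷ xs) c rewrite ∑-const xs c = sym (suc-* (+ length xs) c)

∑-++ : (xs ys : List A) (f : A → ℤ) → ∑ (xs ++ ys) f ≡ ∑ xs f + ∑ ys f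
∑-++ []       ys f = sym (+-identityˡ _)
∑-++ (x ∷ xs) ys f rewrite ∑-++ xs ys f = sym (+-assoc (f x) (∑ xs f) (∑ ys f))

∑-map : (g : A → B) (xs : List A) (f : B → ℤ) → ∑ (map g xs) f ≡ ∑ xs (λ x → f (g x))
∑-map g []       f = refl
∑-map g (x ∷ xs) f = cong (_+_ (f (g x))) (∑-map g xs f)

∑-product : (g : A → B → C) (xs : List A) (ys : List B) (f : C → ℤ) →
            ∑ (cartesianProductWith g xs ys) f ≡ ∑ xs (λ x → ∑ ys (λ y → f (g x y)))
∑-product g []       ys f = refl
∑-product g (x ∷ xs) ys f = trans (∑-++ (map (g x) ys) _ f) (cong₂ _+_ (∑-map (g x) ys f) (∑-product g xs ys f))

-- `f` dominates `c` times the indicator of the complement of `P`; the bound is put as a lower bound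
-- on the count of `P`, without division.
markov : {P : A → Set} (P? : Decidable P) (c : ℕ) (xs : List A) (f : A → ℤ) →
         (∀ x → 0ℤ ℤ.≤ f x) → (∀ x → ¬ P x → + c ℤ.≤ f x) →
         + length xs * + c ℤ.≤ + length (filter P? xs) * + c + ∑ xs f
markov P? c []       f 0≤f c≤f = ≤-refl
markov P? c (x ∷ xs) f 0≤f c≤f with P? x
... | yes _ = begin
  + suc (length xs) * + c   ≡⟨ suc-* (+ length xs) (+ c) ⟩
  + c + + length xs * + c   ≤⟨ +-monoʳ-≤ (+ c) (markov P? c xs f 0≤f c≤f) ⟩
  + c + (F * + c + S)       ≡⟨ cong (λ z → + c + (F * + c + z)) (sym (+-identityˡ S)) ⟩
  + c + (F * + c + (0ℤ + S)) ≤⟨ +-monoʳ-≤ (+ c) (+-monoʳ-≤ (F * + c) (+-monoˡ-≤ S (0≤f x))) ⟩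
  + c + (F * + c + (f x + S)) ≡⟨ +-assoc (+ c) (F * + c) (f x + S) ⟨
  + c + F * + c + (f x + S) ≡⟨ cong (_+ (f x + S)) (suc-* F (+ c)) ⟨
  ℤ.suc F * + c + (f x + S) ∎
  where
  open ≤-Reasoning
  F S : ℤ
  F = + length (filter P? xs)
  S = ∑ xs f
... | no ¬Px = begin
  + suc (length xs) * + c   ≡⟨ suc-* (+ length xs) (+ c) ⟩
  + c + + length xs * + c   ≤⟨ +-mono-≤ (c≤f x ¬Px) (markov P? c xs f 0≤f c≤f) ⟩
  f x + (F * + c + S)       ≡⟨ exchange (f x) (F * + c) S ⟩
  F * + c + (f x + S)       ∎
  where
  open ≤-Reasoning
  F S : ℤ
  F = + length (filter P? xs)
  S = ∑ xs f
  exchange : ∀ a b c → a + (b + c) ≡ b + (a + c)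
  exchange = solve-∀

square≡∣∣² : ∀ i → i * i ≡ + (∣ i ∣ ℕ.* ∣ i ∣)
square≡∣∣² (+ n)    = sym (pos-* n n)
square≡∣∣² -[1+ n ] = refl

-- Markov's inequality for `q` times the square of `z`; `c` and `q` together encode a rational
-- threshold c/q for that square.
chebyshev : {P : A → Set} (P? : Decidable P) (c q v : ℕ) (xs : List A) (z : A → ℤ) →
  (∀ x → ¬ P x → + c ℤ.≤ + q * (z x * z x)) → ∑ xs (λ x → z x * z x) ℤ.≤ + v →
  length xs ℕ.* c ≤ length (filter P? xs) ℕ.* c ℕ.+ q ℕ.* v
chebyshev P? c q v xs z far small = drop‿+≤+ (begin
  + (length xs ℕ.* c)                        ≡⟨ pos-* (length xs) c ⟩
  + length xs * + c                          ≤⟨ markov P? c xs (λ x → + q * (z x * z x)) nonneg far ⟩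
  + l * + c + ∑ xs (λ x → + q * (z x * z x)) ≡⟨ cong (_+_ (+ l * + c)) (∑-*ˡ xs (+ q) (λ x → z x * z x)) ⟩
  + l * + c + + q * ∑ xs (λ x → z x * z x)   ≤⟨ +-monoʳ-≤ (+ l * + c) (*-monoˡ-≤-nonNeg (+ q) small) ⟩
  + l * + c + + q * + v                      ≡⟨ cong₂ _+_ (pos-* l c) (pos-* q v) ⟨
  + (l ℕ.* c ℕ.+ q ℕ.* v)                    ∎)
  where
  open ≤-Reasoning
  l : ℕ
  l = length (filter P? xs)
  nonneg : ∀ x → 0ℤ ℤ.≤ + q * (z x * z x)
  nonneg x = subst (0ℤ ℤ.≤_) (trans (pos-* q _) (cong (_*_ (+ q)) (sym (square≡∣∣² (z x))))) (+≤+ ℕ.z≤n)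

pick : List (Fin k × A) → A → Fin k → A
pick []             z x = z
pick ((a , y) ∷ ps) z x with x ≟ a
... | yes _ = y
... | no  _ = pick ps z x

-- Adding an exception at `a` alters a single summand, from `f z` to `f y`: `a` occurs once in `xs`
-- and not among the other exceptions.
∑-pick : (f : A → ℤ) (xs : List (Fin k)) → Unique xs → (∀ x → x ∈ xs) →
         ∀ ps → Unique (map proj₁ ps) → ∀ z →
         ∑ xs (λ x → f (pick ps z x)) ≡ + length xs * f z + ∑ ps (λ (_ , y) → f y - f z)
∑-pick f xs _ _ [] _ z = trans (∑-const xs (f z)) (sym (+-identityʳ _))
∑-pick {k = k} f xs xs! ∈xs ((a , y) ∷ ps) (a∉ ∷ ps!) z = begin
  ∑ xs (λ x → f (pick ((a , y) ∷ ps) z x))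
    ≡⟨ override xs xs! (∈xs a) ⟩
  ∑ xs (λ x → f (pick ps z x)) + (f y - f (pick ps z a))
    ≡⟨ cong₂ (λ s p → s + (f y - f p)) (∑-pick f xs xs! ∈xs ps ps! z) (pick-fresh ps a∉) ⟩
  + length xs * f z + ∑ ps (λ (_ , y) → f y - f z) + (f y - f z)
    ≡⟨ rearrange (+ length xs * f z) (∑ ps (λ (_ , y) → f y - f z)) (f y - f z) ⟩
  + length xs * f z + ((f y - f z) + ∑ ps (λ (_ , y) → f y - f z)) ∎
  where
  open ≡-Reasoning
  rearrange : ∀ a b c → a + b + c ≡ a + (c + b)
  rearrange = solve-∀
  shift : ∀ y p s → y + s ≡ p + s + (y - p)
  shift = solve-∀
  pick-fresh : ∀ ps → All (a ≢_) (map proj₁ ps) → pick ps z a ≡ z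
  pick-fresh []             []         = refl
  pick-fresh ((b , _) ∷ ps) (a≢b ∷ a∉) with a ≟ b
  ... | yes a≡b = contradiction a≡b a≢b
  ... | no  _   = pick-fresh ps a∉
  unaffected : ∀ xs → All (a ≢_) xs →
               ∑ xs (λ x → f (pick ((a , y) ∷ ps) z x)) ≡ ∑ xs (λ x → f (pick ps z x))
  unaffected []       []         = refl
  unaffected (x ∷ xs) (a≢x ∷ a∉) with x ≟ a
  ... | yes x≡a = contradiction (sym x≡a) a≢x
  ... | no  _   = cong (_+_ (f (pick ps z x))) (unaffected xs a∉)
  override : ∀ xs → Unique xs → a ∈ xs →
             ∑ xs (λ x → f (pick ((a , y) ∷ ps) z x)) ≡
             ∑ xs (λ x → f (pick ps z x)) + (f y - f (pick ps z a))
  override (x ∷ xs) (x∉ ∷ _) (here refl) with a ≟ a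
  ... | yes _  = trans (cong (_+_ (f y)) (unaffected xs x∉)) (shift (f y) (f (pick ps z a)) _)
  ... | no a≢a = contradiction refl a≢a
  override (x ∷ xs) (x∉ ∷ xs!) (there a∈) with x ≟ a
  ... | yes refl = contradiction refl (All.lookup x∉ a∈)
  ... | no  _    = trans (cong (_+_ (f (pick ps z x))) (override xs xs! a∈)) (sym (+-assoc (f (pick ps z x)) _ _))

-- All words of a given length, and the second moment of a martingale over them.

words : (k n : ℕ) → List (Word k n)
words k zero    = [ [] ]
words k (suc n) = cartesianProductWith _∷_ (allFin k) (words k n)

words-unique : ∀ k n → Unique (words k n)
words-unique k zero    = [] ∷ []
words-unique k (suc n) = cartesianProductWith⁺ _∷_ ∷-injective (allFin⁺ k) (words-unique k n)

length-product : (g : A → B → C) (xs : List A) (ys : List B) →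
                 length (cartesianProductWith g xs ys) ≡ length xs ℕ.* length ys
length-product g []       ys = refl
length-product g (x ∷ xs) ys = trans (length-++ (map (g x) ys)) (cong₂ ℕ._+_ (length-map (g x) ys) (length-product g xs ys))

length-allFin : ∀ k → length (allFin k) ≡ k
length-allFin k = length-tabulate {n = k} (λ i → i)

length-words : ∀ k n → length (words k n) ≡ k ^ n
length-words k zero    = refl
length-words k (suc n) = trans (length-product _∷_ (allFin k) (words k n)) (cong₂ ℕ._*_ (length-allFin k) (length-words k n))

module Martingale {k : ℕ} {S : Set} (next : S → Fin k → S) (increment : S → Fin k → ℤ)
  (centred : ∀ s → ∑ (allFin k) (increment s) ≡ 0ℤ)
  (C : ℕ) (bounded : ∀ s x → increment s x * increment s x ℤ.≤ + C) where

  value : S → Word k n → ℤ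
  value s []      = 0ℤ
  value s (x ∷ w) = increment s x + value (next s x) w

  square : S → Word k n → ℤ
  square s w = value s w * value s w

  ∑-value : ∀ n s → ∑ (words k n) (value s) ≡ 0ℤ
  ∑-value zero    s = refl
  ∑-value (suc n) s = begin
    ∑ (words k (suc n)) (value s)
      ≡⟨ ∑-product _∷_ (allFin k) (words k n) (value s) ⟩
    ∑ (allFin k) (λ x → ∑ (words k n) (λ w → increment s x + value (next s x) w))
      ≡⟨ ∑-cong (allFin k) (λ x → begin
           ∑ (words k n) (λ w → increment s x + value (next s x) w)
             ≡⟨ ∑-+ (words k n) _ _ ⟩
           ∑ (words k n) (λ _ → increment s x) + ∑ (words k n) (value (next s x))
             ≡⟨ cong₂ _+_ (∑-const (words k n) _) (∑-value n (next s x)) ⟩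
           + length (words k n) * increment s x + 0ℤ
             ≡⟨ +-identityʳ _ ⟩
           + length (words k n) * increment s x ∎) ⟩
    ∑ (allFin k) (λ x → + length (words k n) * increment s x)
      ≡⟨ ∑-*ˡ (allFin k) (+ length (words k n)) (increment s) ⟩
    + length (words k n) * ∑ (allFin k) (increment s)
      ≡⟨ cong (+ length (words k n) *_) (centred s) ⟩
    + length (words k n) * 0ℤ
      ≡⟨ *-zeroʳ (+ length (words k n)) ⟩
    0ℤ ∎
    where open ≡-Reasoning

  -- Orthogonality of increments: once the first letter is fixed, the cross term is a constant times
  -- a sum of centred values and vanishes, so each letter adds at most `C` per word.
  ∑-square : ∀ n s → ∑ (words k n) (square s) ℤ.≤ + (n ℕ.* (C ℕ.* k ^ n))
  ∑-square zero    s = ≤-refl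
  ∑-square (suc n) s = begin
    ∑ (words k (suc n)) (square s)
      ≡⟨ ∑-product _∷_ (allFin k) (words k n) (square s) ⟩
    ∑ (allFin k) (λ x → ∑ (words k n) (λ w → square s (x ∷ w)))
      ≤⟨ ∑-mono (allFin k) first-letter ⟩
    ∑ (allFin k) (λ _ → N * + C + + (n ℕ.* (C ℕ.* k ^ n)))
      ≡⟨ ∑-const (allFin k) _ ⟩
    + length (allFin k) * (N * + C + + (n ℕ.* (C ℕ.* k ^ n)))
      ≡⟨ cong₂ (λ a b → + a * (+ b * + C + + (n ℕ.* (C ℕ.* k ^ n)))) (length-allFin k) (length-words k n) ⟩
    + k * (+ (k ^ n) * + C + + (n ℕ.* (C ℕ.* k ^ n)))
      ≡⟨ cong (λ z → + k * (z + + (n ℕ.* (C ℕ.* k ^ n)))) (pos-* (k ^ n) C) ⟨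
    + k * + (k ^ n ℕ.* C ℕ.+ n ℕ.* (C ℕ.* k ^ n))
      ≡⟨ pos-* k _ ⟨
    + (k ℕ.* (k ^ n ℕ.* C ℕ.+ n ℕ.* (C ℕ.* k ^ n)))
      ≡⟨ cong +_ (collect k (k ^ n) C n) ⟩
    + (suc n ℕ.* (C ℕ.* k ^ suc n)) ∎
    where
    open ≤-Reasoning
    N : ℤ
    N = + length (words k n)
    collect : ∀ k K C n → k ℕ.* (K ℕ.* C ℕ.+ n ℕ.* (C ℕ.* K)) ≡ suc n ℕ.* (C ℕ.* (k ℕ.* K))
    collect = ℕ.solve-∀
    expand : ∀ d z → (d + z) * (d + z) ≡ d * d + ((d + d) * z + z * z)
    expand = solve-∀
    first-letter : ∀ x → ∑ (words k n) (λ w → square s (x ∷ w)) ℤ.≤ N * + C + + (n ℕ.* (C ℕ.* k ^ n))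
    first-letter x = begin
      ∑ (words k n) (λ w → square s (x ∷ w))
        ≡⟨ ∑-cong (words k n) (λ w → expand d (value s′ w)) ⟩
      ∑ (words k n) (λ w → d * d + ((d + d) * value s′ w + square s′ w))
        ≡⟨ ∑-+ (words k n) _ _ ⟩
      ∑ (words k n) (λ _ → d * d) + ∑ (words k n) (λ w → (d + d) * value s′ w + square s′ w)
        ≡⟨ cong₂ _+_ (∑-const (words k n) _) (∑-+ (words k n) _ _) ⟩
      N * (d * d) + (∑ (words k n) (λ w → (d + d) * value s′ w) + ∑ (words k n) (square s′))
        ≡⟨ cong (λ z → N * (d * d) + (z + ∑ (words k n) (square s′))) cross ⟩
      N * (d * d) + (0ℤ + ∑ (words k n) (square s′))
        ≡⟨ cong (_+_ (N * (d * d))) (+-identityˡ _) ⟩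
      N * (d * d) + ∑ (words k n) (square s′)
        ≤⟨ +-mono-≤ (*-monoˡ-≤-nonNeg N (bounded s x)) (∑-square n s′) ⟩
      N * + C + + (n ℕ.* (C ℕ.* k ^ n)) ∎
      where
      d = increment s x
      s′ = next s x
      cross : ∑ (words k n) (λ w → (d + d) * value s′ w) ≡ 0ℤ
      cross = trans (∑-*ˡ (words k n) (d + d) (value s′))
                    (trans (cong ((d + d) *_) (∑-value n s′)) (*-zeroʳ (d + d)))

-- The queue automaton

-- Distinctness is stored in the states so that letters with a special transition can be counted
-- without overlap.
data State (k : ℕ) : Set where
  ∅    : State k
  ⟨_⟩   : Fin k → State k
  ab   : (a b : Fin k) → Unique (a ∷ b ∷ []) → State k
  abb  : (a b : Fin k) → Unique (a ∷ b ∷ []) → State k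
  abc  : (a b c : Fin k) → Unique (a ∷ b ∷ c ∷ []) → State k
  abcc : (a b c : Fin k) → Unique (a ∷ b ∷ c ∷ []) → State k

queue : State k → List (Fin k)
queue ∅              = []
queue ⟨ a ⟩          = a ∷ []
queue (ab a b _)     = a ∷ b ∷ []
queue (abb a b _)    = a ∷ b ∷ b ∷ []
queue (abc a b c _)  = a ∷ b ∷ c ∷ []
queue (abcc a b c _) = a ∷ b ∷ c ∷ c ∷ []

extend : {a b x : Fin k} → Unique (a ∷ b ∷ []) → x ≢ a → x ≢ b → Unique (a ∷ b ∷ x ∷ [])
extend ((a≢b ∷ []) ∷ _) x≢a x≢b = (a≢b ∷ ≢-sym x≢a ∷ []) ∷ (≢-sym x≢b ∷ []) ∷ [] ∷ []

-- The Boolean records a hit. Where the queue would leave the six shapes, it is shortened or the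
-- letter read is ignored. In `abc` a further `c` is queued rather than matched, since matching it
-- would give up both `a` and `b`.
move : State k → Fin k → Bool × State k
move ∅ x = false , ⟨ x ⟩
move ⟨ a ⟩ x with x ≟ a
... | yes _   = true , ∅
... | no  x≢a = false , ab a x ((≢-sym x≢a ∷ []) ∷ [] ∷ [])
move (ab a b u) x with x ≟ a | x ≟ b
... | yes _   | _       = true , ⟨ b ⟩
... | no  _   | yes _   = true , ∅
... | no  x≢a | no  x≢b = false , abc a b x (extend u x≢a x≢b)
move (abb a b u) x with x ≟ a | x ≟ b
... | yes _   | _       = true , ⟨ b ⟩
... | no  _   | yes _   = true , ⟨ b ⟩
... | no  x≢a | no  x≢b = false , abc a b x (extend u x≢a x≢b)
move (abc a b c u@(_ ∷ bc!)) x with x ≟ a | x ≟ b | x ≟ c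
... | yes _ | _     | _     = true , ab b c bc!
... | no  _ | yes _ | _     = true , ⟨ c ⟩
... | no  _ | no  _ | yes _ = false , abcc a b c u
... | no  _ | no  _ | no  _ = false , abc a b c u
move (abcc a b c u@(_ ∷ bc!)) x with x ≟ a | x ≟ b | x ≟ c
... | yes _ | _     | _     = true , abb b c bc!
... | no  _ | yes _ | _     = true , ⟨ c ⟩
... | no  _ | no  _ | yes _ = true , ⟨ c ⟩
... | no  _ | no  _ | no  _ = false , abcc a b c u

next : State k → Fin k → State k
next s x = proj₂ (move s x)

hits : Bool → ℕ
hits true  = 1
hits false = 0

-- Completions grow backwards through the word: `match` serves a hit, `push` a queued letter, `drop`
-- an ignored one, and `weaken` the queue letters given up.
move-sound : ∀ (s : State k) x {w : Word k n} → Completion (queue (next s x)) w t →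
             Completion (queue s) (x ∷ w) (hits (proj₁ (move s x)) ℕ.+ t)
move-sound ∅ x r = push r
move-sound ⟨ a ⟩ x r with x ≟ a
... | yes refl = match r
... | no  _    = push r
move-sound (ab a b u) x r with x ≟ a | x ≟ b
... | yes refl | _        = match r
... | no  _    | yes refl = weaken (a ∷ʳ ⊆-refl) (match r)
... | no  _    | no  _    = push r
move-sound (abb a b u) x r with x ≟ a | x ≟ b
... | yes refl | _        = match (weaken (b ∷ʳ ⊆-refl) r)
... | no  _    | yes refl = weaken (a ∷ʳ ⊆-refl) (match r)
... | no  _    | no  _    = weaken (refl ∷ b ∷ʳ ⊆-refl) (push r)
move-sound (abc a b c (_ ∷ _)) x r with x ≟ a | x ≟ b | x ≟ c
... | yes refl | _        | _        = match r
... | no  _    | yes refl | _        = weaken (a ∷ʳ ⊆-refl) (match r)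
... | no  _    | no  _    | yes refl = push r
... | no  _    | no  _    | no  _    = drop r
move-sound (abcc a b c (_ ∷ _)) x r with x ≟ a | x ≟ b | x ≟ c
... | yes refl | _        | _        = match r
... | no  _    | yes refl | _        = weaken (a ∷ʳ ⊆-refl) (match (weaken (c ∷ʳ ⊆-refl) r))
... | no  _    | no  _    | yes refl = weaken (a ∷ʳ b ∷ʳ ⊆-refl) (match r)
... | no  _    | no  _    | no  _    = drop r

score : State k → Word k n → ℕ
score s []      = 0
score s (x ∷ w) = hits (proj₁ (move s x)) ℕ.+ score (next s x) w

final : State k → Word k n → State k
final s []      = s
final s (x ∷ w) = final (next s x) w

score-sound : ∀ (s : State k) (w : Word k n) → Completion (queue s) w (score s w)
score-sound s []      = stop
score-sound s (x ∷ w) = move-sound s x (score-sound (next s x) w)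

-- Drift and potentials as polynomials in `k`.

horner : List ℤ → ℤ → ℤ
horner []       x = 0ℤ
horner (c ∷ cs) x = c + x * horner cs x

horner-nonneg : (cs : List ℕ) (j : ℕ) → ∃ λ v → horner (map +_ cs) (+ j) ≡ + v
horner-nonneg []       j = 0 , refl
horner-nonneg (c ∷ cs) j with horner-nonneg cs j
... | v , eq = c ℕ.+ j ℕ.* v , cong (_+_ (+ c)) (trans (cong (+ j *_) eq) (sym (pos-* j v)))

-- Coefficients of polynomials in k, constant term first.  Drift and potentials, all multiplied
-- by scale, are the solution of the linear system that balance states, with potential 0 at ∅.
scaleᶜ driftᶜ : List ℤ
scaleᶜ = -[1+ 1 ] ∷ + 2 ∷ + 20 ∷ + 2 ∷ + 4 ∷ []
driftᶜ = + 0 ∷ + 8 ∷ -[1+ 3 ] ∷ + 9 ∷ []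

potentialᶜ : Vec (List ℤ) 6
potentialᶜ = []
           ∷ driftᶜ
           ∷ (-[1+ 1 ] ∷ + 0 ∷ + 4 ∷ + 14 ∷ [])
           ∷ (+ 6 ∷ -[1+ 3 ] ∷ + 13 ∷ + 14 ∷ [])
           ∷ (-[1+ 1 ] ∷ + 6 ∷ + 17 ∷ + 15 ∷ [])
           ∷ (+ 0 ∷ + 6 ∷ + 19 ∷ + 14 ∷ + 1 ∷ [])
           ∷ []

shape : State k → Fin 6
shape ∅              = 0F
shape ⟨ _ ⟩          = 1F
shape (ab _ _ _)     = 2F
shape (abb _ _ _)    = 3F
shape (abc _ _ _ _)  = 4F
shape (abcc _ _ _ _) = 5F

-- The chain lumped to shapes, and its balance equations.

Outcome : Set
Outcome = Bool × Fin 6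

outcome : State k → Fin k → Outcome
outcome s x = proj₁ (move s x) , shape (next s x)

-- Only letters of the queue, at most three distinct ones, behave specially; all others enter
-- through their number alone, which makes one-step sums polynomial in `k`.
exceptions : State k → List (Fin k × Outcome)
exceptions ∅              = []
exceptions ⟨ a ⟩          = (a , true , 0F) ∷ []
exceptions (ab a b _)     = (a , true , 1F) ∷ (b , true , 0F) ∷ []
exceptions (abb a b _)    = (a , true , 1F) ∷ (b , true , 1F) ∷ []
exceptions (abc a b c _)  = (a , true , 2F) ∷ (b , true , 1F) ∷ (c , false , 5F) ∷ []
exceptions (abcc a b c _) = (a , true , 3F) ∷ (b , true , 1F) ∷ (c , true , 1F) ∷ []

fallback : State k → Outcome
fallback ∅              = false , 1F
fallback ⟨ _ ⟩          = false , 2F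
fallback (ab _ _ _)     = false , 4F
fallback (abb _ _ _)    = false , 4F
fallback (abc _ _ _ _)  = false , 4F
fallback (abcc _ _ _ _) = false , 5F

exceptions-unique : (s : State k) → Unique (map proj₁ (exceptions s))
exceptions-unique ∅              = []
exceptions-unique ⟨ _ ⟩          = [] ∷ []
exceptions-unique (ab _ _ u)     = u
exceptions-unique (abb _ _ u)    = u
exceptions-unique (abc _ _ _ u)  = u
exceptions-unique (abcc _ _ _ u) = u

outcome≗pick : (s : State k) (x : Fin k) → outcome s x ≡ pick (exceptions s) (fallback s) x
outcome≗pick ∅ x = refl
outcome≗pick ⟨ a ⟩ x with x ≟ a
... | yes _ = refl
... | no  _ = refl
outcome≗pick (ab a b _) x with x ≟ a
... | yes _ = refl
... | no  _ with x ≟ b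
...   | yes _ = refl
...   | no  _ = refl
outcome≗pick (abb a b _) x with x ≟ a
... | yes _ = refl
... | no  _ with x ≟ b
...   | yes _ = refl
...   | no  _ = refl
outcome≗pick (abc a b c (_ ∷ _)) x with x ≟ a
... | yes _ = refl
... | no  _ with x ≟ b
...   | yes _ = refl
...   | no  _ with x ≟ c
...     | yes _ = refl
...     | no  _ = refl
outcome≗pick (abcc a b c (_ ∷ _)) x with x ≟ a
... | yes _ = refl
... | no  _ with x ≟ b
...   | yes _ = refl
...   | no  _ with x ≟ c
...     | yes _ = refl
...     | no  _ = refl

scale drift : ℕ → ℤ
scale k = horner scaleᶜ (+ k)
drift k = horner driftᶜ (+ k)

potential : ℕ → Fin 6 → ℤ
potential k i = horner (Vec.lookup potentialᶜ i) (+ k)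

worth : ℕ → Outcome → ℤ
worth k (b , i) = scale k * + hits b + potential k i

-- In terms of j = k − 3 the scale and the margin of drift / scale over 1.64 / (k + 1) have
-- natural coefficients, hence are nonnegative.
scale³ᶜ margin³ᶜ : List ℕ
scale³ᶜ  = 562 ∷ 608 ∷ 254 ∷ 50 ∷ 4 ∷ []
margin³ᶜ = 231 ∷ 14188 ∷ 11844 ∷ 3100 ∷ 244 ∷ []

module _ where
  open +-*-Solver

  hornerP : List ℤ → Polynomial n → Polynomial n
  hornerP []       x = con 0ℤ
  hornerP (c ∷ cs) x = con c :+ x :* hornerP cs x

  worthP : Outcome → Polynomial n → Polynomial n
  worthP (b , i) x = hornerP scaleᶜ x :* con (+ hits b) :+ hornerP (Vec.lookup potentialᶜ i) x

  -- Mirrors the equation of `balance` term by term, so that evaluating it at `k` gives that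
  -- equation definitionally.
  balanceP : State k → Polynomial n → Polynomial n × Polynomial n
  balanceP {n = n} s x = x :* z :+ gains (exceptions s)
      := x :* (hornerP (Vec.lookup potentialᶜ (shape s)) x :+ hornerP driftᶜ x)
    where
    z : Polynomial n
    z = worthP (fallback s) x
    gains : List (Fin _ × Outcome) → Polynomial n
    gains []             = con 0ℤ
    gains ((_ , o) ∷ os) = (worthP o x :- z) :+ gains os

  -- The Poisson equation of the chain, summed over the next letter: the mean of scaled hit plus new
  -- potential is old potential plus drift. It is a polynomial identity in `k` for each shape.
  balance : (s : State k) →
    + k * worth k (fallback s) + ∑ (exceptions s) (λ (_ , o) → worth k o - worth k (fallback s))
    ≡ + k * (potential k (shape s) + drift k)
  balance {k} s@∅              = solve 1 (balanceP s) refl (+ k)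
  balance {k} s@(⟨ _ ⟩)      = solve 1 (balanceP s) refl (+ k)
  balance {k} s@(ab _ _ _)     = solve 1 (balanceP s) refl (+ k)
  balance {k} s@(abb _ _ _)    = solve 1 (balanceP s) refl (+ k)
  balance {k} s@(abc _ _ _ _)  = solve 1 (balanceP s) refl (+ k)
  balance {k} s@(abcc _ _ _ _) = solve 1 (balanceP s) refl (+ k)

  scale-shifted : ∀ j → horner scaleᶜ (+ 3 + j) ≡ horner (map +_ scale³ᶜ) j
  scale-shifted = solve 1 (λ j → hornerP scaleᶜ (con (+ 3) :+ j)
    := hornerP (map +_ scale³ᶜ) j) refl

  -- The separate `+ 1` is the strict surplus of the drift that later yields a gap linear in `n`;
  -- the rest of the margin only has to be nonnegative.
  rate-shifted : ∀ j → + 100 * (+ 1 + (+ 3 + j)) * horner driftᶜ (+ 3 + j)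
               ≡ + 164 * horner scaleᶜ (+ 3 + j) + + 1 + horner (map +_ margin³ᶜ) j
  rate-shifted = solve 1 (λ j → con (+ 100) :* (con (+ 1) :+ (con (+ 3) :+ j)) :* hornerP driftᶜ (con (+ 3) :+ j)
    := con (+ 164) :* hornerP scaleᶜ (con (+ 3) :+ j) :+ con (+ 1)
       :+ hornerP (map +_ margin³ᶜ) j) refl

∑-worth : (s : State k) → ∑ (allFin k) (λ x → worth k (outcome s x)) ≡ + k * (potential k (shape s) + drift k)
∑-worth {k} s = begin
  ∑ (allFin k) (λ x → worth k (outcome s x))
    ≡⟨ ∑-cong (allFin k) (λ x → cong (worth k) (outcome≗pick s x)) ⟩
  ∑ (allFin k) (λ x → worth k (pick (exceptions s) (fallback s) x))
    ≡⟨ ∑-pick (worth k) (allFin k) (allFin⁺ k) ∈-allFin (exceptions s) (exceptions-unique s) (fallback s) ⟩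
  + length (allFin k) * worth k (fallback s) + ∑ (exceptions s) (λ (_ , o) → worth k o - worth k (fallback s))
    ≡⟨ cong (λ l → + l * worth k (fallback s) + ∑ (exceptions s) (λ (_ , o) → worth k o - worth k (fallback s))) (length-allFin k) ⟩
  + k * worth k (fallback s) + ∑ (exceptions s) (λ (_ , o) → worth k o - worth k (fallback s))
    ≡⟨ balance s ⟩
  + k * (potential k (shape s) + drift k) ∎
  where open ≡-Reasoning

-- The martingale of the automaton

increment : State k → Fin k → ℤ
increment {k} s x = worth k (outcome s x) - (potential k (shape s) + drift k)

increment-centred : (s : State k) → ∑ (allFin k) (increment s) ≡ 0ℤ
increment-centred {k} s = begin
  ∑ (allFin k) (increment s)
    ≡⟨ ∑-+ (allFin k) (λ x → worth k (outcome s x)) (λ _ → - m) ⟩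
  ∑ (allFin k) (λ x → worth k (outcome s x)) + ∑ (allFin k) (λ _ → - m)
    ≡⟨ cong₂ _+_ (∑-worth s) (∑-const (allFin k) (- m)) ⟩
  + k * m + + length (allFin k) * - m
    ≡⟨ cong (λ l → + k * m + + l * - m) (length-allFin k) ⟩
  + k * m + + k * - m
    ≡⟨ cancel (+ k) m ⟩
  0ℤ ∎
  where
  open ≡-Reasoning
  m : ℤ
  m = potential k (shape s) + drift k
  cancel : ∀ a b → a * b + a * - b ≡ 0ℤ
  cancel = solve-∀

lookup≤sum : (xs : Vec ℕ n) (i : Fin n) → Vec.lookup xs i ≤ Vec.sum xs
lookup≤sum (x ∷ xs) Fin.zero    = ℕ.m≤m+n x (Vec.sum xs)
lookup≤sum (x ∷ xs) (Fin.suc i) = ℕ.≤-trans (lookup≤sum xs i) (ℕ.m≤n+m (Vec.sum xs) x)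

-- A crude stand-in for the maximum over shapes; what matters is independence of `n`.
potential-bound : ℕ → ℕ
potential-bound k = Vec.sum (Vec.tabulate (λ i → ∣ potential k i ∣))

∣potential∣≤ : ∀ k i → ∣ potential k i ∣ ≤ potential-bound k
∣potential∣≤ k i = subst (_≤ potential-bound k) (lookup∘tabulate (λ i → ∣ potential k i ∣) i) (lookup≤sum _ i)

increment-bound : ℕ → ℕ
increment-bound k = (∣ scale k ∣ ℕ.+ potential-bound k) ℕ.+ (potential-bound k ℕ.+ ∣ drift k ∣)

∣increment∣≤ : (s : State k) (x : Fin k) → ∣ increment s x ∣ ≤ increment-bound k
∣increment∣≤ {k} s x = begin
  ∣ worth k o - (potential k (shape s) + drift k) ∣
    ≤⟨ ∣i-j∣≤∣i∣+∣j∣ (worth k o) _ ⟩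
  ∣ worth k o ∣ ℕ.+ ∣ potential k (shape s) + drift k ∣
    ≤⟨ ℕ.+-mono-≤ (∣i+j∣≤∣i∣+∣j∣ (scale k * + hits (proj₁ o)) _) (∣i+j∣≤∣i∣+∣j∣ (potential k (shape s)) _) ⟩
  (∣ scale k * + hits (proj₁ o) ∣ ℕ.+ ∣ potential k (proj₂ o) ∣) ℕ.+ (∣ potential k (shape s) ∣ ℕ.+ ∣ drift k ∣)
    ≤⟨ ℕ.+-mono-≤ (ℕ.+-mono-≤ (hit-bound (proj₁ o)) (∣potential∣≤ k (proj₂ o)))
                  (ℕ.+-monoˡ-≤ ∣ drift k ∣ (∣potential∣≤ k (shape s))) ⟩
  increment-bound k ∎
  where
  open ℕ.≤-Reasoning
  o : Outcome
  o = outcome s x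
  hit-bound : ∀ b → ∣ scale k * + hits b ∣ ≤ ∣ scale k ∣
  hit-bound true  = ℕ.≤-reflexive (cong ∣_∣ (*-identityʳ (scale k)))
  hit-bound false = subst (λ z → ∣ z ∣ ≤ ∣ scale k ∣) (sym (*-zeroʳ (scale k))) ℕ.z≤n

increment²≤ : (s : State k) (x : Fin k) → increment s x * increment s x ℤ.≤ + (increment-bound k ℕ.* increment-bound k)
increment²≤ s x = ≤-trans (≤-reflexive (square≡∣∣² (increment s x)))
                          (+≤+ (ℕ.*-mono-≤ (∣increment∣≤ s x) (∣increment∣≤ s x)))

module Excess (k : ℕ) = Martingale {k} next increment increment-centred
                          (increment-bound k ℕ.* increment-bound k) increment²≤

open Excess

-- The potential differences telescope along the path, leaving only those of the first and last
-- states.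
score-excess : (s : State k) (w : Word k n) →
  scale k * + score s w + potential k (shape (final s w)) ≡
  value k s w + potential k (shape s) + + n * drift k
score-excess {k} s [] = base (scale k) (potential k (shape s)) (drift k)
  where
  base : ∀ a p d → a * 0ℤ + p ≡ 0ℤ + p + 0ℤ * d
  base = solve-∀
score-excess {k} {suc n} s (x ∷ w) = begin
  a * + (h ℕ.+ score s′ w) + p″
    ≡⟨ cong (λ z → a * z + p″) (pos-+ h (score s′ w)) ⟩
  a * (+ h + + score s′ w) + p″
    ≡⟨ split-hit a (+ h) (+ score s′ w) p″ ⟩
  a * + h + (a * + score s′ w + p″)
    ≡⟨ cong (_+_ (a * + h)) (score-excess s′ w) ⟩
  a * + h + (value k s′ w + p′ + + n * d)
    ≡⟨ regroup (a * + h) (value k s′ w) p′ (potential k (shape s)) (+ n) d ⟩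
  a * + h + p′ - (potential k (shape s) + d) + value k s′ w + potential k (shape s) + (+ 1 + + n) * d ∎
  where
  open ≡-Reasoning
  a d p′ p″ : ℤ
  a = scale k
  d = drift k
  h : ℕ
  h = hits (proj₁ (move s x))
  s′ : State k
  s′ = next s x
  p″ = potential k (shape (final s′ w))
  p′ = potential k (shape s′)
  split-hit : ∀ a h g q → a * (h + g) + q ≡ a * h + (a * g + q)
  split-hit = solve-∀
  regroup : ∀ ah v p′ p n d → ah + (v + p′ + n * d) ≡ ah + p′ - (p + d) + v + p + (+ 1 + n) * d
  regroup = solve-∀

-- From the surplus of the drift to large deviations.

record Rate (k : ℕ) : Set where
  field
    a r     : ℕ
    scale≡  : scale k ≡ + a
    margin  : + (100 ℕ.* suc k) * drift k ≡ + 164 * scale k + + 1 + + r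

rate : 3 ≤ k → Rate k
rate 3≤k with ℕ.m≤n⇒∃[o]m+o≡n 3≤k
... | j , refl with horner-nonneg scale³ᶜ j | horner-nonneg margin³ᶜ j
... | a , a≡ | r , r≡ = record
  { a      = a
  ; r      = r
  ; scale≡ = trans (scale-shifted (+ j)) a≡
  ; margin = trans (cong (_* drift (3 ℕ.+ j)) (pos-* 100 (suc (3 ℕ.+ j))))
                   (trans (rate-shifted (+ j)) (cong (_+_ (+ 164 * scale (3 ℕ.+ j) + + 1)) r≡))
  }

-- Used with T = 100 (k + 1) and g the score, which falls short of 1.64 n / (k + 1) by d / T.
-- The shortfalls d, e, h are additive naturals so that the conclusion exhibits its own sign.
excess-negative : ∀ {A D z p : ℤ} (T a r g d e Φ h n : ℕ) →
  A ≡ + a → + T * D ≡ + 164 * A + + 1 + + r →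
  A * + g + p ≡ z + 0ℤ + + n * D → T ℕ.* g ℕ.+ d ≡ 164 ℕ.* n → + Φ - p ≡ + e →
  2 ℕ.* T ℕ.* Φ ℕ.+ h ≡ n →
  + (2 ℕ.* T) * z ≡ - + (n ℕ.+ (h ℕ.+ 2 ℕ.* a ℕ.* d ℕ.+ 2 ℕ.* T ℕ.* e ℕ.+ 2 ℕ.* n ℕ.* r))
excess-negative {A} {D} {z} {p} T a r g d e Φ h n refl TD Ag Tg Φp n≡ = begin
  + (2 ℕ.* T) * z
    ≡⟨ cong₂ _*_ (pos-* 2 T) z≡ ⟩
  + 2 * + T * (+ a * + g + (+ Φ - + e) - + n * D)
    ≡⟨ distribute (+ T) (+ a) (+ g) (+ Φ) (+ e) (+ n) D ⟩
  + 2 * + a * (+ T * + g) + + 2 * + T * (+ Φ - + e) - + 2 * + n * (+ T * D)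
    ≡⟨ cong₂ (λ u v → + 2 * + a * u + + 2 * + T * (+ Φ - + e) - + 2 * + n * v) Tg≡ TD ⟩
  + 2 * + a * (+ 164 * + n - + d) + + 2 * + T * (+ Φ - + e) - + 2 * + n * (+ 164 * + a + + 1 + + r)
    -- The terms in 164 a n cancel. The surplus 1 contributes 2 n: one `n` pays for the potential
    -- term and leaves `h`, the other remains as the deviation.
    ≡⟨ collect (+ T) (+ a) (+ d) (+ Φ) (+ e) (+ n) (+ r) ⟩
  - (+ n + (+ n - + 2 * + T * + Φ + + 2 * + a * + d + + 2 * + T * + e + + 2 * + n * + r))
    ≡⟨ cong (λ y → - (+ n + (y + + 2 * + a * + d + + 2 * + T * + e + + 2 * + n * + r))) h≡ ⟨
  - (+ n + (+ h + + 2 * + a * + d + + 2 * + T * + e + + 2 * + n * + r))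
    ≡⟨ cong (λ y → - (+ n + y)) (cong₂ _+_ (cong₂ _+_ (cong (_+_ (+ h)) (pos-*₃ 2 a d)) (pos-*₃ 2 T e)) (pos-*₃ 2 n r)) ⟨
  - + (n ℕ.+ (h ℕ.+ 2 ℕ.* a ℕ.* d ℕ.+ 2 ℕ.* T ℕ.* e ℕ.+ 2 ℕ.* n ℕ.* r)) ∎
  where
  open ≡-Reasoning
  pos-*₃ : ∀ a b c → + (a ℕ.* b ℕ.* c) ≡ + a * + b * + c
  pos-*₃ a b c = trans (pos-* (a ℕ.* b) c) (cong (_* + c) (pos-* a b))
  isolate : ∀ x y w → x ≡ y + 0ℤ + w → y ≡ x - w
  isolate x y w refl = cancel y w
    where
    cancel : ∀ y w → y ≡ y + 0ℤ + w - w
    cancel = solve-∀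
  moveʳ : ∀ x y w → x + y ≡ w → x ≡ w - y
  moveʳ x y w refl = cancel x y
    where
    cancel : ∀ x y → x ≡ x + y - y
    cancel = solve-∀
  p≡ : p ≡ + Φ - + e
  p≡ = trans (reflect (+ Φ) p) (cong (_-_ (+ Φ)) Φp)
    where
    reflect : ∀ x y → y ≡ x - (x - y)
    reflect = solve-∀
  z≡ : z ≡ + a * + g + (+ Φ - + e) - + n * D
  z≡ = trans (isolate _ z _ Ag) (cong (λ y → + a * + g + y - + n * D) p≡)
  Tg≡ : + T * + g ≡ + 164 * + n - + d
  Tg≡ = moveʳ _ (+ d) _ (trans (cong (_+ + d) (sym (pos-* T g))) (trans (cong +_ Tg) (pos-* 164 n)))
  h≡ : + h ≡ + n - + 2 * + T * + Φ
  h≡ = moveʳ (+ h) (+ 2 * + T * + Φ) (+ n)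
    (trans (+-comm (+ h) (+ 2 * + T * + Φ)) (trans (cong (_+ + h) (sym (pos-*₃ 2 T Φ))) (cong +_ n≡)))
  distribute : ∀ T a g Φ e n D → + 2 * T * (a * g + (Φ - e) - n * D) ≡
    + 2 * a * (T * g) + + 2 * T * (Φ - e) - + 2 * n * (T * D)
  distribute = solve-∀
  collect : ∀ T a d Φ e n r →
    + 2 * a * (+ 164 * n - d) + + 2 * T * (Φ - e) - + 2 * n * (+ 164 * a + + 1 + r) ≡
    - (n + (n - + 2 * T * Φ + + 2 * a * d + + 2 * T * e + + 2 * n * r))
  collect = solve-∀

-- Counting the words on which the automaton scores enough.

-- A decidable sufficient condition for `GoodWord`, by which the enumeration of words can be
-- filtered.
Rich : (k n : ℕ) → Word k n → Set
Rich k n w = 164 ℕ.* n ≤ 100 ℕ.* suc k ℕ.* score ∅ w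

rich? : ∀ k n → Decidable (Rich k n)
rich? k n w = 164 ℕ.* n ℕ.≤? 100 ℕ.* suc k ℕ.* score ∅ w

rich⇒good : (w : Word k n) → Rich k n w → GoodWord k n w
rich⇒good w rich = score ∅ w , completion⇒twins (score-sound ∅ w) , rich

weight : ℕ → ℕ
weight k = 2 ℕ.* (100 ℕ.* suc k)

-- A low score pushes the martingale down to -n / `weight k` or below, since the drift exceeds the
-- required rate and the potentials are bounded; squaring gives the threshold for Chebyshev's
-- inequality.
poor⇒far : Rate k → weight k ℕ.* potential-bound k ≤ n → (w : Word k n) → ¬ Rich k n w →
           + (n ℕ.* n) ℤ.≤ + (weight k ℕ.* weight k) * square k ∅ w
poor⇒far {k} {n} ρ large w poor = begin
  + (n ℕ.* n)                            ≤⟨ +≤+ (ℕ.*-mono-≤ (ℕ.m≤m+n n c) (ℕ.m≤m+n n c)) ⟩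
  + ((n ℕ.+ c) ℕ.* (n ℕ.+ c))            ≡⟨ pos-* (n ℕ.+ c) (n ℕ.+ c) ⟩
  + (n ℕ.+ c) * + (n ℕ.+ c)              ≡⟨ neg-square (+ (n ℕ.+ c)) ⟩
  - + (n ℕ.+ c) * - + (n ℕ.+ c)          ≡⟨ cong (λ y → y * y) far ⟨
  + weight k * z * (+ weight k * z)    ≡⟨ square-* (+ weight k) z ⟩
  + weight k * + weight k * (z * z)    ≡⟨ cong (_* (z * z)) (pos-* (weight k) (weight k)) ⟨
  + (weight k ℕ.* weight k) * (z * z)  ∎
  where
  open ≤-Reasoning
  open Rate ρ
  z : ℤ
  z = value k ∅ w
  Φ e h d c : ℕ
  Φ = potential-bound k
  pₙ : ℤ
  pₙ = potential k (shape (final ∅ w))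
  e = ∣ + Φ - pₙ ∣
  n-surplus : ∃ λ h → weight k ℕ.* Φ ℕ.+ h ≡ n
  n-surplus = ℕ.m≤n⇒∃[o]m+o≡n large
  h = proj₁ n-surplus
  deficit : ∃ λ d → 100 ℕ.* suc k ℕ.* score ∅ w ℕ.+ d ≡ 164 ℕ.* n
  deficit = ℕ.m≤n⇒∃[o]m+o≡n (ℕ.<⇒≤ (ℕ.≰⇒> poor))
  d = proj₁ deficit
  c = h ℕ.+ 2 ℕ.* a ℕ.* d ℕ.+ 2 ℕ.* (100 ℕ.* suc k) ℕ.* e ℕ.+ 2 ℕ.* n ℕ.* r
  i≤∣i∣ : ∀ i → i ℤ.≤ + ∣ i ∣
  i≤∣i∣ (+ _)    = ≤-refl
  i≤∣i∣ -[1+ _ ] = ℤ.-≤+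
  Φp : + Φ - pₙ ≡ + e
  Φp = sym (0≤i⇒+∣i∣≡i (i≤j⇒0≤j-i (≤-trans (i≤∣i∣ pₙ) (+≤+ (∣potential∣≤ k (shape (final ∅ w)))))))
  far : + weight k * z ≡ - + (n ℕ.+ c)
  -- The start at `∅` has potential 0, which supplies the `0ℤ` expected here.
  far = excess-negative (100 ℕ.* suc k) a r (score ∅ w) d e Φ h n scale≡ margin
          (score-excess ∅ w) (proj₂ deficit) Φp (proj₂ n-surplus)
  neg-square : ∀ x → x * x ≡ - x * - x
  neg-square = solve-∀
  square-* : ∀ x y → x * y * (x * y) ≡ x * x * (y * y)
  square-* = solve-∀

rich-count : Rate k → weight k ℕ.* potential-bound k ≤ n →
  k ^ n ℕ.* (n ℕ.* n) ≤ length (filter (rich? k n) (words k n)) ℕ.* (n ℕ.* n)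
    ℕ.+ weight k ℕ.* weight k ℕ.* (n ℕ.* (increment-bound k ℕ.* increment-bound k ℕ.* k ^ n))
rich-count {k} {n} ρ large =
  subst (λ l → l ℕ.* (n ℕ.* n) ≤ length (filter (rich? k n) (words k n)) ℕ.* (n ℕ.* n)
                 ℕ.+ weight k ℕ.* weight k ℕ.* (n ℕ.* (increment-bound k ℕ.* increment-bound k ℕ.* k ^ n)))
    (length-words k n)
    (chebyshev (rich? k n) (n ℕ.* n) (weight k ℕ.* weight k) _ (words k n) (value k ∅)
      (poor⇒far ρ large) (∑-square k n ∅))

-- After multiplication by `suc m` the error is at most n² W, exactly the difference between `suc m`
-- and `m` copies of n² W; then n² cancels.
absorb-error : ∀ m n W L Q C .{{_ : ℕ.NonZero n}} → suc m ℕ.* (Q ℕ.* C) ≤ n →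
  W ℕ.* (n ℕ.* n) ≤ L ℕ.* (n ℕ.* n) ℕ.+ Q ℕ.* (n ℕ.* (C ℕ.* W)) → m ℕ.* W ≤ suc m ℕ.* L
absorb-error m n W L Q C large W≤ =
  ℕ.*-cancelˡ-≤ n (ℕ.*-cancelˡ-≤ n (ℕ.+-cancelʳ-≤ (n ℕ.* (n ℕ.* W)) _ _ (begin
    n ℕ.* (n ℕ.* (m ℕ.* W)) ℕ.+ n ℕ.* (n ℕ.* W)              ≡⟨ gather m n W ⟩
    suc m ℕ.* (W ℕ.* (n ℕ.* n))                               ≤⟨ ℕ.*-monoʳ-≤ (suc m) W≤ ⟩
    suc m ℕ.* (L ℕ.* (n ℕ.* n) ℕ.+ Q ℕ.* (n ℕ.* (C ℕ.* W)))  ≡⟨ spread m n W L Q C ⟩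
    n ℕ.* (n ℕ.* (suc m ℕ.* L)) ℕ.+ suc m ℕ.* (Q ℕ.* C) ℕ.* (n ℕ.* W)
      ≤⟨ ℕ.+-monoʳ-≤ (n ℕ.* (n ℕ.* (suc m ℕ.* L))) (ℕ.*-monoˡ-≤ (n ℕ.* W) large) ⟩
    n ℕ.* (n ℕ.* (suc m ℕ.* L)) ℕ.+ n ℕ.* (n ℕ.* W) ∎)))
  where
  open ℕ.≤-Reasoning
  gather : ∀ m n W → n ℕ.* (n ℕ.* (m ℕ.* W)) ℕ.+ n ℕ.* (n ℕ.* W) ≡ suc m ℕ.* (W ℕ.* (n ℕ.* n))
  gather = ℕ.solve-∀
  spread : ∀ m n W L Q C → suc m ℕ.* (L ℕ.* (n ℕ.* n) ℕ.+ Q ℕ.* (n ℕ.* (C ℕ.* W))) ≡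
    n ℕ.* (n ℕ.* (suc m ℕ.* L)) ℕ.+ suc m ℕ.* (Q ℕ.* C) ℕ.* (n ℕ.* W)
  spread = ℕ.solve-∀

theorem1p2 : ∀ (k : ℕ) → 3 ≤ k → AAS k (GoodWord k)
-- `error` brings the Chebyshev loss down to a fraction 1/(m+1), `start` lets `n` absorb the
-- potentials, and `suc` makes `n` nonzero for the cancellation.
theorem1p2 k 3≤k m = suc (error ℕ.+ start) , λ n N≤n →
  filter (rich? k n) (words k n) ,
  filter⁺ (rich? k n) (words-unique k n) ,
  All.map (λ {w} → rich⇒good w) (all-filter (rich? k n) (words k n)) ,
  absorb-error m n (k ^ n) _ (weight k ℕ.* weight k) _
    {{ℕ.>-nonZero (ℕ.<-≤-trans ℕ.z<s N≤n)}}
    (ℕ.≤-trans (ℕ.m≤m+n error start) (ℕ.<⇒≤ N≤n))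
    (rich-count (rate 3≤k) (ℕ.≤-trans (ℕ.m≤n+m start error) (ℕ.<⇒≤ N≤n)))
  where
  error start : ℕ
  error = suc m ℕ.* (weight k ℕ.* weight k ℕ.* (increment-bound k ℕ.* increment-bound k))
  start = weight k ℕ.* potential-bound k
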